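{- For all $k,M\in\mathbb{N}$, $$G_{k,1,M}(x)\in\mathbb{N}_0[[x]].$$ Equivalently, for all $a,b,M\in\mathbb{N}$ with $b\mid a$, one has $g_{a,b,a+b}(1,M;q)\in\mathbb{N}_0[[q]]$.
   Context: $\mathbb{N}$ is the set of positive integers and $\mathbb{N}_0=\mathbb{N}\cup\{0\}$. Notation: $(z;q)_n=\prod_{i=0}^{n-1}(1-zq^i)$. For $a,b,m,N,M\in\mathbb{N}$, $$g_{a,b,m}(N,M;q):=\frac{(-q^m;q^m)_{N+M-1}}{(-q^a;q^m)_N\,(q^b;q^m)_M},$$ and for $k,N,M\in\mathbb{N}$, $$G_{k,N,M}(x):=\frac{(-x^{k+1};x^{k+1})_{N+M-1}}{(-x^{k};x^{k+1})_N\,(x;x^{k+1})_M},$$ both expanded as formal power series. When $a=kb$ one has $G_{k,N,M}(q^b)=g_{a,b,a+b}(N,M;q)$. $\mathbb{N}_0[[x]]$ is the set of power series with non-negative integer coefficients. -}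

module Defs where

open import Data.Fin.Base using (Fin; zero; suc; toℕ)
open import Data.Integer.Base as ℤ using (ℤ; 0ℤ; 1ℤ)
import Data.Integer.Properties as ℤₚ
open import Data.Nat.Base as ℕ using (ℕ; zero; suc; _∸_; NonZero)
open import Data.Vec.Base using (Vec; []; _∷_; head; lookup)
open import Relation.Binary.PropositionalEquality
open import Algebra.Properties.CommutativeMonoid.Sum ℤₚ.+-0-commutativeMonoid
  using (sum-syntax; sum⁺-syntax; sum-cong-≗)

infixl 6 _⊖_
infixl 7 _⊛_
infix  8 ⊝_
infixr 9 _^ˢ_

-- ℤ[[x]], a series being its coefficient sequence; equality of series is
-- pointwise equality (_≗_).
Series : Set
Series = ℕ → ℤ

𝟙 : Series
𝟙 zero    = 1ℤ
𝟙 (suc _) = 0ℤ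

X : Series
X zero          = 0ℤ
X (suc zero)    = 1ℤ
X (suc (suc _)) = 0ℤ

⊝_ : Series → Series
(⊝ f) n = ℤ.- f n

_⊖_ : Series → Series → Series
(f ⊖ g) n = f n ℤ.- g n

-- ∑[ i ≤ n ] ranges over i : Fin (suc n).
_⊛_ : Series → Series → Series
(f ⊛ g) n = ∑[ i ≤ n ] (f (toℕ i) ℤ.* g (n ∸ toℕ i))

_^ˢ_ : Series → ℕ → Series
f ^ˢ zero  = 𝟙
f ^ˢ suc n = f ⊛ f ^ˢ n

-- The coefficients c₀, …, cₙ of 1/f when f has constant term 1, stored as
-- cₙ ∷ … ∷ c₀: c₀ = 1 and cₙ₊₁ = - ∑_{i ≤ n} fᵢ₊₁ cₙ₋ᵢ.
invCoeffs : Series → (n : ℕ) → Vec ℤ (suc n)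
invCoeffs f zero    = 1ℤ ∷ []
invCoeffs f (suc n) =
  ℤ.- (∑[ i ≤ n ] (f (suc (toℕ i)) ℤ.* lookup (invCoeffs f n) i)) ∷ invCoeffs f n

inv : (f : Series) → .(f 0 ≡ 1ℤ) → Series
inv f _ n = head (invCoeffs f n)

lookup-invCoeffs : ∀ f .(f₀ : f 0 ≡ 1ℤ) n (i : Fin (suc n)) →
                   lookup (invCoeffs f n) i ≡ inv f f₀ (n ∸ toℕ i)
lookup-invCoeffs f f₀ zero    zero    = refl
lookup-invCoeffs f f₀ (suc n) zero    = refl
lookup-invCoeffs f f₀ (suc n) (suc i) = lookup-invCoeffs f f₀ n i

⊛-inv : ∀ f (f₀ : f 0 ≡ 1ℤ) → f ⊛ inv f f₀ ≗ 𝟙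
⊛-inv f f₀ zero    rewrite f₀ = refl
⊛-inv f f₀ (suc n) = begin
  f 0 ℤ.* (ℤ.- s) ℤ.+ t ≡⟨ cong (λ u → u ℤ.* (ℤ.- s) ℤ.+ t) f₀ ⟩
  1ℤ ℤ.* (ℤ.- s) ℤ.+ t  ≡⟨ cong (ℤ._+ t) (ℤₚ.*-identityˡ (ℤ.- s)) ⟩
  ℤ.- s ℤ.+ t           ≡⟨ cong (λ u → ℤ.- u ℤ.+ t) s≡t ⟩
  ℤ.- t ℤ.+ t           ≡⟨ ℤₚ.+-inverseˡ t ⟩
  0ℤ                    ∎
  where
  open ≡-Reasoning
  s t : ℤ
  s = ∑[ i ≤ n ] (f (suc (toℕ i)) ℤ.* lookup (invCoeffs f n) i)
  t = ∑[ i ≤ n ] (f (suc (toℕ i)) ℤ.* inv f f₀ (n ∸ toℕ i))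
  s≡t : s ≡ t
  s≡t = sum-cong-≗ (λ i → cong (f (suc (toℕ i)) ℤ.*_) (lookup-invCoeffs f f₀ n i))

-- (z ; q)ₙ
poch : Series → Series → ℕ → Series
poch z q zero    = 𝟙
poch z q (suc n) = poch z q n ⊛ (𝟙 ⊖ z ⊛ q ^ˢ n)

⊛-const₁ : ∀ f g → f 0 ≡ 1ℤ → g 0 ≡ 1ℤ → (f ⊛ g) 0 ≡ 1ℤ
⊛-const₁ f g f₀ g₀ rewrite f₀ | g₀ = refl

poch-const₁ : ∀ z q n → z 0 ≡ 0ℤ → poch z q n 0 ≡ 1ℤ
poch-const₁ z q zero    z₀ = refl
poch-const₁ z q (suc n) z₀ =
  ⊛-const₁ (poch z q n) (𝟙 ⊖ z ⊛ q ^ˢ n) (poch-const₁ z q n z₀) factor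
  where
  factor : (𝟙 ⊖ z ⊛ q ^ˢ n) 0 ≡ 1ℤ
  factor rewrite z₀ = refl

X^-const₀ : ∀ a .{{_ : NonZero a}} → (X ^ˢ a) 0 ≡ 0ℤ
X^-const₀ (suc a) = refl

-- (-u ; q)_N (v ; q)_M
denom : (u v q : Series) (N M : ℕ) → Series
denom u v q N M = poch (⊝ u) q N ⊛ poch v q M

denom-const₁ : ∀ u v q N M → u 0 ≡ 0ℤ → v 0 ≡ 0ℤ → denom u v q N M 0 ≡ 1ℤ
denom-const₁ u v q N M u₀ v₀ =
  ⊛-const₁ (poch (⊝ u) q N) (poch v q M)
    (poch-const₁ (⊝ u) q N (cong ℤ.-_ u₀)) (poch-const₁ v q M v₀)

-- In g and G, N + M ≥ 1 is intended, since ∸ is truncated subtraction.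
-- X plays the role of q in g and of x in G.
g : (a b m N M : ℕ) .{{_ : NonZero a}} .{{_ : NonZero b}} → Series
g a b m N M =
  poch (⊝ X ^ˢ m) (X ^ˢ m) (N ℕ.+ M ∸ 1)
    ⊛ inv (denom (X ^ˢ a) (X ^ˢ b) (X ^ˢ m) N M)
          (denom-const₁ (X ^ˢ a) (X ^ˢ b) (X ^ˢ m) N M (X^-const₀ a) (X^-const₀ b))

G : (k N M : ℕ) .{{_ : NonZero k}} → Series
G k N M =
  poch (⊝ X ^ˢ (k ℕ.+ 1)) (X ^ˢ (k ℕ.+ 1)) (N ℕ.+ M ∸ 1)
    ⊛ inv (denom (X ^ˢ k) X (X ^ˢ (k ℕ.+ 1)) N M)
          (denom-const₁ (X ^ˢ k) X (X ^ˢ (k ℕ.+ 1)) N M (X^-const₀ k) refl)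

-- Membership in ℕ₀[[x]].
NonNegativeCoeffs : Series → Set
NonNegativeCoeffs f = ∀ n → 0ℤ ℤ.≤ f n

{-# OPTIONS --safe #-}

-- Let u = vᵏ be the argument of the lone factor 1 + u of the denominator.
-- Then 1/(1 + u) = (1 − u)/(1 − u²), and 1 − u = (1 − v)(1 + v + ⋯ + vᵏ⁻¹)
-- cancels the first factor 1 − v of (v ; q)_M.  What remains of the
-- denominator is a product of factors 1 − z with z ∈ x ℕ₀[[x]], and every
-- numerator factor has non-negative coefficients.
module Submission where

open import Defs
open import Data.Nat.Base using (ℕ; _+_; NonZero)
open import Data.Nat.Divisibility using (_∣_)
open import Data.Product.Base using (_×_)

open import Algebra.Bundles using (CommutativeRing)
open import Algebra.Structures using (IsAbelianGroup; IsCommutativeRing)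
open import Data.Integer.Base as ℤ using (ℤ; 0ℤ; 1ℤ; +≤+)
import Data.Integer.Properties as ℤₚ
import Data.Integer.Tactic.RingSolver as ℤ-Solver
open import Data.Nat.Base using (zero; suc; _*_; _∸_; _≤_; _<_; z≤n; s≤s)
open import Data.Nat.Divisibility using (divides)
open import Data.Nat.Induction using (<-rec)
import Data.Nat.Properties as ℕₚ
open import Data.Fin.Base using (toℕ)
open import Data.Product.Base using (_,_)
open import Function.Base using (_∘_)
open import Level using (0ℓ)
open import Relation.Binary.PropositionalEquality
  using (_≡_; _≗_; refl; sym; trans; cong; cong₂; subst; module ≡-Reasoning)
open import Algebra.Properties.CommutativeMonoid.Sum ℤₚ.+-0-commutativeMonoid
  using (sum-cong-≗)

-- The commutative ring of formal power series over the integers.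

infixl 6 _⊕_

_⊕_ : Series → Series → Series
(f ⊕ g) n = f n ℤ.+ g n

𝟘 : Series
𝟘 _ = 0ℤ

⊛-cong : ∀ {f f′ g g′} → f ≗ f′ → g ≗ g′ → f ⊛ g ≗ f′ ⊛ g′
⊛-cong f≗f′ g≗g′ n =
  sum-cong-≗ {suc n} (λ i → cong₂ ℤ._*_ (f≗f′ (toℕ i)) (g≗g′ (n ∸ toℕ i)))

-- The inductions below rest on the recursion
-- (f ⊛ g) (suc n) = f 0 * g (suc n) + ((f ∘ suc) ⊛ g) n, which holds by
-- computation.

⊛-zeroˡ : ∀ f → 𝟘 ⊛ f ≗ 𝟘
⊛-zeroˡ f zero    = refl
⊛-zeroˡ f (suc n) = trans (ℤₚ.+-identityˡ _) (⊛-zeroˡ f n)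

⊛-identityˡ : ∀ f → 𝟙 ⊛ f ≗ f
⊛-identityˡ f zero    = trans (ℤₚ.+-identityʳ _) (ℤₚ.*-identityˡ (f 0))
⊛-identityˡ f (suc n) = trans
  (cong₂ ℤ._+_ (ℤₚ.*-identityˡ (f (suc n))) (⊛-zeroˡ f n))
  (ℤₚ.+-identityʳ _)

⊛-distribʳ-⊕ : ∀ h f g → (f ⊕ g) ⊛ h ≗ f ⊛ h ⊕ g ⊛ h
⊛-distribʳ-⊕ h f g zero    = eq (f 0) (g 0) (h 0)
  where
  eq : ∀ a b c → (a ℤ.+ b) ℤ.* c ℤ.+ 0ℤ ≡ (a ℤ.* c ℤ.+ 0ℤ) ℤ.+ (b ℤ.* c ℤ.+ 0ℤ)
  eq = ℤ-Solver.solve-∀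
⊛-distribʳ-⊕ h f g (suc n) = trans
  (cong (ℤ._+_ ((f 0 ℤ.+ g 0) ℤ.* h (suc n))) (⊛-distribʳ-⊕ h (f ∘ suc) (g ∘ suc) n))
  (eq (f 0) (g 0) (h (suc n)) (((f ∘ suc) ⊛ h) n) (((g ∘ suc) ⊛ h) n))
  where
  eq : ∀ a b c d e → (a ℤ.+ b) ℤ.* c ℤ.+ (d ℤ.+ e) ≡ (a ℤ.* c ℤ.+ d) ℤ.+ (b ℤ.* c ℤ.+ e)
  eq = ℤ-Solver.solve-∀

-- Shifting `f ⊛ g` by one leaves a summand `f 0` times the shifted `g`. This lemma lets
-- associativity pull that constant out of a product.
⊛-scaleˡ : ∀ c f g n → ((λ i → c ℤ.* f i) ⊛ g) n ≡ c ℤ.* (f ⊛ g) n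
⊛-scaleˡ c f g zero    = eq c (f 0) (g 0)
  where
  eq : ∀ c a b → c ℤ.* a ℤ.* b ℤ.+ 0ℤ ≡ c ℤ.* (a ℤ.* b ℤ.+ 0ℤ)
  eq = ℤ-Solver.solve-∀
⊛-scaleˡ c f g (suc n) = trans
  (cong (ℤ._+_ (c ℤ.* f 0 ℤ.* g (suc n))) (⊛-scaleˡ c (f ∘ suc) g n))
  (eq c (f 0) (g (suc n)) (((f ∘ suc) ⊛ g) n))
  where
  eq : ∀ c a b d → c ℤ.* a ℤ.* b ℤ.+ c ℤ.* d ≡ c ℤ.* (a ℤ.* b ℤ.+ d)
  eq = ℤ-Solver.solve-∀

⊛-assoc : ∀ f g h → (f ⊛ g) ⊛ h ≗ f ⊛ (g ⊛ h)
⊛-assoc f g h zero    = eq (f 0) (g 0) (h 0)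
  where
  eq : ∀ a b c → (a ℤ.* b ℤ.+ 0ℤ) ℤ.* c ℤ.+ 0ℤ ≡ a ℤ.* (b ℤ.* c ℤ.+ 0ℤ) ℤ.+ 0ℤ
  eq = ℤ-Solver.solve-∀
⊛-assoc f g h (suc n) = begin
  -- By computation `(f ⊛ g) ∘ suc` is `f₀g′ ⊕ f′ ⊛ g`, so distributivity splits off `(f′ ⊛ g) ⊛ h`,
  -- to which the induction hypothesis applies.
  f₀g₀hₙ₊₁ ℤ.+ ((f₀g′ ⊕ f′ ⊛ g) ⊛ h) n
    ≡⟨ cong (ℤ._+_ f₀g₀hₙ₊₁) (⊛-distribʳ-⊕ h f₀g′ (f′ ⊛ g) n) ⟩
  f₀g₀hₙ₊₁ ℤ.+ ((f₀g′ ⊛ h) n ℤ.+ ((f′ ⊛ g) ⊛ h) n)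
    ≡⟨ cong (ℤ._+_ f₀g₀hₙ₊₁) (cong₂ ℤ._+_ (⊛-scaleˡ (f 0) (g ∘ suc) h n) (⊛-assoc f′ g h n)) ⟩
  f₀g₀hₙ₊₁ ℤ.+ (f 0 ℤ.* ((g ∘ suc) ⊛ h) n ℤ.+ (f′ ⊛ (g ⊛ h)) n)
    ≡⟨ eq (f 0) (g 0) (h (suc n)) (((g ∘ suc) ⊛ h) n) ((f′ ⊛ (g ⊛ h)) n) ⟩
  f 0 ℤ.* (g ⊛ h) (suc n) ℤ.+ (f′ ⊛ (g ⊛ h)) n ∎
  where
  open ≡-Reasoning
  f₀g₀hₙ₊₁ : ℤ
  f₀g₀hₙ₊₁ = (f 0 ℤ.* g 0 ℤ.+ 0ℤ) ℤ.* h (suc n)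
  f′ f₀g′ : Series
  f′ = f ∘ suc
  f₀g′ i = f 0 ℤ.* g (suc i)
  eq : ∀ a b c d e → (a ℤ.* b ℤ.+ 0ℤ) ℤ.* c ℤ.+ (a ℤ.* d ℤ.+ e) ≡ a ℤ.* (b ℤ.* c ℤ.+ d) ℤ.+ e
  eq = ℤ-Solver.solve-∀

-- The convolution sum unfolds at its first term, whereas here its last term is split off.
-- Commutativity needs both forms, because swapping the factors reverses the sum.
⊛-sucʳ : ∀ f g n → (f ⊛ g) (suc n) ≡ f (suc n) ℤ.* g 0 ℤ.+ (f ⊛ (g ∘ suc)) n
⊛-sucʳ f g zero    = eq (f 0) (f 1) (g 0) (g 1)
  where
  eq : ∀ a b c d → a ℤ.* d ℤ.+ (b ℤ.* c ℤ.+ 0ℤ) ≡ b ℤ.* c ℤ.+ (a ℤ.* d ℤ.+ 0ℤ)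
  eq = ℤ-Solver.solve-∀
⊛-sucʳ f g (suc n) = trans
  (cong (ℤ._+_ (f 0 ℤ.* g (suc (suc n)))) (⊛-sucʳ (f ∘ suc) g n))
  (eq (f 0 ℤ.* g (suc (suc n))) (f (suc (suc n)) ℤ.* g 0) (((f ∘ suc) ⊛ (g ∘ suc)) n))
  where
  eq : ∀ a b c → a ℤ.+ (b ℤ.+ c) ≡ b ℤ.+ (a ℤ.+ c)
  eq = ℤ-Solver.solve-∀

⊛-comm : ∀ f g → f ⊛ g ≗ g ⊛ f
⊛-comm f g zero    = cong (ℤ._+ 0ℤ) (ℤₚ.*-comm (f 0) (g 0))
⊛-comm f g (suc n) = trans
  (cong₂ ℤ._+_ (ℤₚ.*-comm (f 0) (g (suc n))) (⊛-comm (f ∘ suc) g n))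
  (sym (⊛-sucʳ g f n))

⊕-isAbelianGroup : IsAbelianGroup _≗_ _⊕_ 𝟘 ⊝_
⊕-isAbelianGroup = record
  { isGroup = record
    { isMonoid = record
      { isSemigroup = record
        { isMagma = record
          { isEquivalence = record
            { refl  = λ _ → refl
            ; sym   = λ f≗g n → sym (f≗g n)
            ; trans = λ f≗g g≗h n → trans (f≗g n) (g≗h n)
            }
          ; ∙-cong = λ f≗f′ g≗g′ n → cong₂ ℤ._+_ (f≗f′ n) (g≗g′ n)
          }
        ; assoc = λ f g h n → ℤₚ.+-assoc (f n) (g n) (h n)
        }
      ; identity = (λ f n → ℤₚ.+-identityˡ (f n)) , (λ f n → ℤₚ.+-identityʳ (f n))
      }
    ; inverse = (λ f n → ℤₚ.+-inverseˡ (f n)) , (λ f n → ℤₚ.+-inverseʳ (f n))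
    ; ⁻¹-cong = λ f≗g n → cong ℤ.-_ (f≗g n)
    }
  ; comm = λ f g n → ℤₚ.+-comm (f n) (g n)
  }

⊕-⊛-isCommutativeRing : IsCommutativeRing _≗_ _⊕_ _⊛_ ⊝_ 𝟘 𝟙
⊕-⊛-isCommutativeRing = record
  { isRing = record
    { +-isAbelianGroup = ⊕-isAbelianGroup
    ; *-cong     = ⊛-cong
    ; *-assoc    = ⊛-assoc
    ; *-identity = ⊛-identityˡ , λ f n → trans (⊛-comm f 𝟙 n) (⊛-identityˡ f n)
    ; distrib    =
        (λ h f g n → trans (⊛-comm h (f ⊕ g) n)
          (trans (⊛-distribʳ-⊕ h f g n) (cong₂ ℤ._+_ (⊛-comm f h n) (⊛-comm g h n))))
      , ⊛-distribʳ-⊕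
    }
  ; *-comm = ⊛-comm
  }

⊕-⊛-commutativeRing : CommutativeRing 0ℓ 0ℓ
⊕-⊛-commutativeRing = record { isCommutativeRing = ⊕-⊛-isCommutativeRing }

open CommutativeRing ⊕-⊛-commutativeRing
  using ( setoid; semiring; ring; *-commutativeMonoid
        ; *-congˡ; *-congʳ; *-identityʳ; zeroʳ; distribˡ; +-cong; +-congˡ; +-congʳ)
  renaming (refl to ≗-refl; sym to ≗-sym)
open import Algebra.Properties.Ring ring using (-‿distribˡ-*; x[y-z]≈xy-xz; [y-z]x≈yx-zx)
open import Algebra.Properties.Semiring.Exp semiring using (_^_; ^-congˡ; ^-assocʳ)
open import Algebra.Solver.CommutativeMonoid *-commutativeMonoid
  using (solve; _⊜_) renaming (_⊕_ to _:*_)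
open import Relation.Binary.Reasoning.Setoid setoid

-- Powers, geometric sums and the first factor of a Pochhammer product.

^ˢ≗^ : ∀ f n → f ^ˢ n ≗ f ^ n
^ˢ≗^ f zero    = ≗-refl
^ˢ≗^ f (suc n) = *-congˡ {f} (^ˢ≗^ f n)

^ˢ-assocʳ : ∀ f m n → (f ^ˢ m) ^ˢ n ≗ f ^ˢ (m * n)
^ˢ-assocʳ f m n = begin
  (f ^ˢ m) ^ˢ n ≈⟨ ^ˢ≗^ (f ^ˢ m) n ⟩
  (f ^ˢ m) ^ n  ≈⟨ ^-congˡ n (^ˢ≗^ f m) ⟩
  (f ^ m) ^ n   ≈⟨ ^-assocʳ f m n ⟩
  f ^ (m * n)   ≈⟨ ^ˢ≗^ f (m * n) ⟨
  f ^ˢ (m * n)  ∎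

⊖-telescope : ∀ f g h → f ⊖ g ⊕ (g ⊖ h) ≗ f ⊖ h
⊖-telescope f g h n = eq (f n) (g n) (h n)
  where
  eq : ∀ a b c → (a ℤ.- b) ℤ.+ (b ℤ.- c) ≡ a ℤ.- c
  eq = ℤ-Solver.solve-∀

-- Horner form of 1 + v + ⋯ + vᵏ⁻¹. Each step multiplies by `v` on the left, as `_^ˢ_` does, so the
-- telescoping induction needs no law of exponents.
geometricSum : Series → ℕ → Series
geometricSum v zero    = 𝟘
geometricSum v (suc k) = 𝟙 ⊕ v ⊛ geometricSum v k

geometricSum-telescope : ∀ v k → (𝟙 ⊖ v) ⊛ geometricSum v k ≗ 𝟙 ⊖ v ^ˢ k
geometricSum-telescope v zero    = begin
  (𝟙 ⊖ v) ⊛ 𝟘 ≈⟨ zeroʳ (𝟙 ⊖ v) ⟩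
  𝟘           ≈⟨ (λ n → ℤₚ.+-inverseʳ (𝟙 n)) ⟨
  𝟙 ⊖ 𝟙       ∎
geometricSum-telescope v (suc k) = begin
  (𝟙 ⊖ v) ⊛ (𝟙 ⊕ v ⊛ S)
    ≈⟨ distribˡ (𝟙 ⊖ v) 𝟙 (v ⊛ S) ⟩
  (𝟙 ⊖ v) ⊛ 𝟙 ⊕ (𝟙 ⊖ v) ⊛ (v ⊛ S)
    ≈⟨ +-cong (*-identityʳ (𝟙 ⊖ v))
         (solve 3 (λ a v S → (a :* (v :* S)) ⊜ (v :* (a :* S))) ≗-refl (𝟙 ⊖ v) v S) ⟩
  𝟙 ⊖ v ⊕ v ⊛ ((𝟙 ⊖ v) ⊛ S)
    ≈⟨ +-congˡ {𝟙 ⊖ v} (*-congˡ {v} (geometricSum-telescope v k)) ⟩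
  𝟙 ⊖ v ⊕ v ⊛ (𝟙 ⊖ v ^ˢ k)
    ≈⟨ +-congˡ {𝟙 ⊖ v} (x[y-z]≈xy-xz v 𝟙 (v ^ˢ k)) ⟩
  𝟙 ⊖ v ⊕ (v ⊛ 𝟙 ⊖ v ⊛ v ^ˢ k)
    ≈⟨ +-congˡ {𝟙 ⊖ v} (+-congʳ (*-identityʳ v)) ⟩
  𝟙 ⊖ v ⊕ (v ⊖ v ⊛ v ^ˢ k)
    ≈⟨ ⊖-telescope 𝟙 v (v ⊛ v ^ˢ k) ⟩
  𝟙 ⊖ v ⊛ v ^ˢ k ∎
  where
  S = geometricSum v k

[𝟙⊖u][𝟙⊕u] : ∀ u → (𝟙 ⊖ u) ⊛ (𝟙 ⊕ u) ≗ 𝟙 ⊖ u ⊛ u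
[𝟙⊖u][𝟙⊕u] u = begin
  (𝟙 ⊖ u) ⊛ (𝟙 ⊕ u)
    ≈⟨ distribˡ (𝟙 ⊖ u) 𝟙 u ⟩
  (𝟙 ⊖ u) ⊛ 𝟙 ⊕ (𝟙 ⊖ u) ⊛ u
    ≈⟨ +-cong (*-identityʳ (𝟙 ⊖ u)) ([y-z]x≈yx-zx u 𝟙 u) ⟩
  𝟙 ⊖ u ⊕ (𝟙 ⊛ u ⊖ u ⊛ u)
    ≈⟨ +-congˡ {𝟙 ⊖ u} (+-congʳ (⊛-identityˡ u)) ⟩
  𝟙 ⊖ u ⊕ (u ⊖ u ⊛ u)
    ≈⟨ ⊖-telescope 𝟙 u (u ⊛ u) ⟩
  𝟙 ⊖ u ⊛ u ∎

𝟙⊖-cong : ∀ {f g} → f ≗ g → 𝟙 ⊖ f ≗ 𝟙 ⊖ g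
𝟙⊖-cong f≗g n = cong (λ c → 𝟙 n ℤ.- c) (f≗g n)

-- `poch` grows at its last factor, but the factor to be cancelled against the geometric sum is the
-- first one. The induction only reassociates z(q qⁿ) to (z q)qⁿ in the last factor.
poch-sucˡ : ∀ z q n → poch z q (suc n) ≗ (𝟙 ⊖ z) ⊛ poch (z ⊛ q) q n
poch-sucˡ z q zero    = begin
  𝟙 ⊛ (𝟙 ⊖ z ⊛ 𝟙) ≈⟨ ⊛-comm 𝟙 (𝟙 ⊖ z ⊛ 𝟙) ⟩
  (𝟙 ⊖ z ⊛ 𝟙) ⊛ 𝟙 ≈⟨ *-congʳ (𝟙⊖-cong (*-identityʳ z)) ⟩
  (𝟙 ⊖ z) ⊛ 𝟙     ∎
poch-sucˡ z q (suc n) = begin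
  poch z q (suc n) ⊛ (𝟙 ⊖ z ⊛ (q ⊛ q ^ˢ n))
    ≈⟨ ⊛-cong (poch-sucˡ z q n) (𝟙⊖-cong (≗-sym (⊛-assoc z q (q ^ˢ n)))) ⟩
  ((𝟙 ⊖ z) ⊛ poch (z ⊛ q) q n) ⊛ (𝟙 ⊖ z ⊛ q ⊛ q ^ˢ n)
    ≈⟨ ⊛-assoc (𝟙 ⊖ z) (poch (z ⊛ q) q n) (𝟙 ⊖ z ⊛ q ⊛ q ^ˢ n) ⟩
  (𝟙 ⊖ z) ⊛ poch (z ⊛ q) q (suc n) ∎

-- Closure properties of series with non-negative coefficients.

0≤+ : ∀ {i j} → 0ℤ ℤ.≤ i → 0ℤ ℤ.≤ j → 0ℤ ℤ.≤ i ℤ.+ j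
0≤+ = ℤₚ.+-mono-≤

0≤* : ∀ {i j} → 0ℤ ℤ.≤ i → 0ℤ ℤ.≤ j → 0ℤ ℤ.≤ i ℤ.* j
0≤* {ℤ.+ m} {ℤ.+ n} _ _ = subst (0ℤ ℤ.≤_) (ℤₚ.pos-* m n) (+≤+ z≤n)

nonNeg-resp-≗ : ∀ {f g} → f ≗ g → NonNegativeCoeffs f → NonNegativeCoeffs g
nonNeg-resp-≗ f≗g f≥0 n = subst (0ℤ ℤ.≤_) (f≗g n) (f≥0 n)

-- The n-th coefficient of a product sees `g` only up to index `n`. The bounded hypothesis serves
-- the strong induction for 1/(1 - z), where only earlier coefficients are known to be non-negative.
⊛-nonNeg-upTo : ∀ {f g} n → NonNegativeCoeffs f →
                (∀ {i} → i ≤ n → 0ℤ ℤ.≤ g i) → 0ℤ ℤ.≤ (f ⊛ g) n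
⊛-nonNeg-upTo zero    f≥0 g≥0 = 0≤+ (0≤* (f≥0 0) (g≥0 z≤n)) (+≤+ z≤n)
⊛-nonNeg-upTo (suc n) f≥0 g≥0 =
  0≤+ (0≤* (f≥0 0) (g≥0 ℕₚ.≤-refl))
      (⊛-nonNeg-upTo n (f≥0 ∘ suc) (g≥0 ∘ ℕₚ.m≤n⇒m≤1+n))

⊛-nonNeg : ∀ {f g} → NonNegativeCoeffs f → NonNegativeCoeffs g → NonNegativeCoeffs (f ⊛ g)
⊛-nonNeg f≥0 g≥0 n = ⊛-nonNeg-upTo n f≥0 (λ {i} _ → g≥0 i)

⊕-nonNeg : ∀ {f g} → NonNegativeCoeffs f → NonNegativeCoeffs g → NonNegativeCoeffs (f ⊕ g)
⊕-nonNeg f≥0 g≥0 n = 0≤+ (f≥0 n) (g≥0 n)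

𝟘-nonNeg : NonNegativeCoeffs 𝟘
𝟘-nonNeg _ = +≤+ z≤n

𝟙-nonNeg : NonNegativeCoeffs 𝟙
𝟙-nonNeg zero    = +≤+ z≤n
𝟙-nonNeg (suc _) = +≤+ z≤n

X-nonNeg : NonNegativeCoeffs X
X-nonNeg zero          = +≤+ z≤n
X-nonNeg (suc zero)    = +≤+ z≤n
X-nonNeg (suc (suc _)) = +≤+ z≤n

^ˢ-nonNeg : ∀ {f} n → NonNegativeCoeffs f → NonNegativeCoeffs (f ^ˢ n)
^ˢ-nonNeg zero    f≥0 = 𝟙-nonNeg
^ˢ-nonNeg (suc n) f≥0 = ⊛-nonNeg f≥0 (^ˢ-nonNeg n f≥0)

geometricSum-nonNeg : ∀ {v} k → NonNegativeCoeffs v → NonNegativeCoeffs (geometricSum v k)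
geometricSum-nonNeg zero    v≥0 = 𝟘-nonNeg
geometricSum-nonNeg (suc k) v≥0 =
  ⊕-nonNeg 𝟙-nonNeg (⊛-nonNeg v≥0 (geometricSum-nonNeg k v≥0))

-- The two signs cancel, which makes the factors of `poch (⊝ z) q n` visibly non-negative when `z`
-- and `q` are.
𝟙⊖⊝⊛ : ∀ z w → 𝟙 ⊕ z ⊛ w ≗ 𝟙 ⊖ (⊝ z) ⊛ w
𝟙⊖⊝⊛ z w n = cong (ℤ._+_ (𝟙 n))
  (trans (sym (ℤₚ.neg-involutive ((z ⊛ w) n))) (cong ℤ.-_ (-‿distribˡ-* z w n)))

poch-⊝-nonNeg : ∀ {z q} n → NonNegativeCoeffs z → NonNegativeCoeffs q →
                NonNegativeCoeffs (poch (⊝ z) q n)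
poch-⊝-nonNeg zero z≥0 q≥0 = 𝟙-nonNeg
poch-⊝-nonNeg {z} {q} (suc n) z≥0 q≥0 = ⊛-nonNeg (poch-⊝-nonNeg n z≥0 q≥0)
  (nonNeg-resp-≗ (𝟙⊖⊝⊛ z (q ^ˢ n)) (⊕-nonNeg 𝟙-nonNeg (⊛-nonNeg z≥0 (^ˢ-nonNeg n q≥0))))

-- Denominators whose reciprocals have non-negative coefficients.

-- When D has constant term 1, this says that 1/D has non-negative coefficients.
DividesNonNeg : Series → Set
DividesNonNeg D = ∀ {F} → NonNegativeCoeffs (D ⊛ F) → NonNegativeCoeffs F

𝟙-dividesNonNeg : DividesNonNeg 𝟙
𝟙-dividesNonNeg {F} = nonNeg-resp-≗ (⊛-identityˡ F)

⊛-dividesNonNeg : ∀ {D E} → DividesNonNeg D → DividesNonNeg E → DividesNonNeg (D ⊛ E)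
⊛-dividesNonNeg {D} {E} D∣ E∣ {F} DEF≥0 = E∣ (D∣ (nonNeg-resp-≗ (⊛-assoc D E F) DEF≥0))

-- F = (1 − z) F + z F, and the n-th coefficient of z F only involves F i for i < n.
𝟙⊖-dividesNonNeg : ∀ {z} → NonNegativeCoeffs z → z 0 ≡ 0ℤ → DividesNonNeg (𝟙 ⊖ z)
𝟙⊖-dividesNonNeg {z} z≥0 z₀ {F} DF≥0 = <-rec _ step
  where
  split : (𝟙 ⊖ z) ⊛ F ⊕ z ⊛ F ≗ F
  split = begin
    (𝟙 ⊖ z) ⊛ F ⊕ z ⊛ F       ≈⟨ +-congʳ ([y-z]x≈yx-zx F 𝟙 z) ⟩
    (𝟙 ⊛ F ⊖ z ⊛ F) ⊕ z ⊛ F   ≈⟨ (λ n → cancel ((𝟙 ⊛ F) n) ((z ⊛ F) n)) ⟩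
    𝟙 ⊛ F                     ≈⟨ ⊛-identityˡ F ⟩
    F                         ∎
    where
    cancel : ∀ a b → (a ℤ.- b) ℤ.+ b ≡ a
    cancel = ℤ-Solver.solve-∀

  zF≥0 : ∀ n → (∀ {i} → i < n → 0ℤ ℤ.≤ F i) → 0ℤ ℤ.≤ (z ⊛ F) n
  zF≥0 zero    F≥0 rewrite z₀ = +≤+ z≤n
  -- Once `z 0` is replaced by zero, the term containing `F (suc n)` reduces to `0ℤ`. What is left
  -- is `(z ∘ suc) ⊛ F` at `n`.
  zF≥0 (suc n) F≥0 rewrite z₀ =
    0≤+ {0ℤ} (+≤+ z≤n) (⊛-nonNeg-upTo n (z≥0 ∘ suc) (F≥0 ∘ s≤s))

  step : ∀ n → (∀ {i} → i < n → 0ℤ ℤ.≤ F i) → 0ℤ ℤ.≤ F n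
  step n F≥0 = subst (0ℤ ℤ.≤_) (split n) (0≤+ (DF≥0 n) (zF≥0 n F≥0))

⊛-const₀ : ∀ f g → f 0 ≡ 0ℤ → (f ⊛ g) 0 ≡ 0ℤ
⊛-const₀ f g f₀ rewrite f₀ = refl

poch-dividesNonNeg : ∀ {z q} n → NonNegativeCoeffs z → z 0 ≡ 0ℤ → NonNegativeCoeffs q →
                     DividesNonNeg (poch z q n)
poch-dividesNonNeg zero z≥0 z₀ q≥0 {F} = 𝟙-dividesNonNeg {F}
poch-dividesNonNeg {z} {q} (suc n) z≥0 z₀ q≥0 {F} =
  ⊛-dividesNonNeg {poch z q n} {𝟙 ⊖ z ⊛ q ^ˢ n}
    (poch-dividesNonNeg n z≥0 z₀ q≥0)
    (𝟙⊖-dividesNonNeg (⊛-nonNeg z≥0 (^ˢ-nonNeg n q≥0)) (⊛-const₀ z (q ^ˢ n) z₀))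
    {F}

-- Quotients with a single factor 1 + u in the denominator.

-- The quotient `F` is specified by an equation, so the argument multiplies instead of inverting.
-- Multiplying by the geometric sum `S` turns the equation into S A = (1 - u²) P F with `P` the
-- product (v q ; q)_M. The left side is non-negative, and 1 - u² and `P` can then be divided out.
-- The index `suc M` guarantees that the factor 1 - v is present.
quotient-nonNeg : ∀ {u v q A F} k M → u ≗ v ^ˢ k →
  NonNegativeCoeffs u → u 0 ≡ 0ℤ → NonNegativeCoeffs v → v 0 ≡ 0ℤ →
  NonNegativeCoeffs q → NonNegativeCoeffs A →
  denom u v q 1 (suc M) ⊛ F ≗ A → NonNegativeCoeffs F
quotient-nonNeg {u} {v} {q} {A} {F} k M u≗vᵏ u≥0 u₀ v≥0 v₀ q≥0 A≥0 DF≗A =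
  ⊛-dividesNonNeg {𝟙 ⊖ u ⊛ u} {P}
    (𝟙⊖-dividesNonNeg (⊛-nonNeg u≥0 u≥0) (⊛-const₀ u u u₀))
    (poch-dividesNonNeg M (⊛-nonNeg v≥0 q≥0) (⊛-const₀ v q v₀) q≥0)
    (nonNeg-resp-≗ SA≗ (⊛-nonNeg (geometricSum-nonNeg k v≥0) A≥0))
  where
  P = poch (v ⊛ q) q M
  S = geometricSum v k

  𝟙⊕u : poch (⊝ u) q 1 ≗ 𝟙 ⊕ u
  𝟙⊕u = begin
    𝟙 ⊛ (𝟙 ⊖ (⊝ u) ⊛ 𝟙) ≈⟨ ⊛-identityˡ (𝟙 ⊖ (⊝ u) ⊛ 𝟙) ⟩
    𝟙 ⊖ (⊝ u) ⊛ 𝟙       ≈⟨ 𝟙⊖⊝⊛ u 𝟙 ⟨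
    𝟙 ⊕ u ⊛ 𝟙           ≈⟨ +-congˡ {𝟙} (*-identityʳ u) ⟩
    𝟙 ⊕ u               ∎

  SA≗ : S ⊛ A ≗ ((𝟙 ⊖ u ⊛ u) ⊛ P) ⊛ F
  SA≗ = begin
    S ⊛ A
      ≈⟨ *-congˡ {S} DF≗A ⟨
    S ⊛ (denom u v q 1 (suc M) ⊛ F)
      ≈⟨ *-congˡ {S} (*-congʳ {F} (⊛-cong 𝟙⊕u (poch-sucˡ v q M))) ⟩
    S ⊛ (((𝟙 ⊕ u) ⊛ ((𝟙 ⊖ v) ⊛ P)) ⊛ F)
      -- The reordering places 1 - v beside `S`; their product is 1 - vᵏ = 1 - u, which then meets 1
      -- + u.
      ≈⟨ solve 5 (λ S b a P F → (S :* ((b :* (a :* P)) :* F)) ⊜ ((((a :* S) :* b) :* P) :* F))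
               ≗-refl S (𝟙 ⊕ u) (𝟙 ⊖ v) P F ⟩
    ((((𝟙 ⊖ v) ⊛ S) ⊛ (𝟙 ⊕ u)) ⊛ P) ⊛ F
      ≈⟨ *-congʳ {F} (*-congʳ {P} (*-congʳ {𝟙 ⊕ u} (geometricSum-telescope v k))) ⟩
    (((𝟙 ⊖ v ^ˢ k) ⊛ (𝟙 ⊕ u)) ⊛ P) ⊛ F
      ≈⟨ *-congʳ {F} (*-congʳ {P} (*-congʳ {𝟙 ⊕ u} (𝟙⊖-cong u≗vᵏ))) ⟨
    (((𝟙 ⊖ u) ⊛ (𝟙 ⊕ u)) ⊛ P) ⊛ F
      ≈⟨ *-congʳ {F} (*-congʳ {P} ([𝟙⊖u][𝟙⊕u] u)) ⟩
    ((𝟙 ⊖ u ⊛ u) ⊛ P) ⊛ F ∎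

⊛-inv-cancel : ∀ D A (D₀ : D 0 ≡ 1ℤ) → D ⊛ (A ⊛ inv D D₀) ≗ A
⊛-inv-cancel D A D₀ = begin
  D ⊛ (A ⊛ inv D D₀)
    ≈⟨ solve 3 (λ D A E → (D :* (A :* E)) ⊜ (A :* (D :* E))) ≗-refl D A (inv D D₀) ⟩
  A ⊛ (D ⊛ inv D D₀)
    ≈⟨ *-congˡ {A} (⊛-inv D D₀) ⟩
  A ⊛ 𝟙
    ≈⟨ *-identityʳ A ⟩
  A ∎

-- Common shape of both families: u = xᵏ, v = x, q = xᵏ⁺¹ for `G`, and u = xᵃ, v = xᵇ, q = xᵃ⁺ᵇ for
-- `g`. With N = 1 the numerator length `1 + suc M ∸ 1` computes to `suc M`.
fraction-nonNeg : ∀ {u v q} k M → u ≗ v ^ˢ k →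
  NonNegativeCoeffs u → (u₀ : u 0 ≡ 0ℤ) → NonNegativeCoeffs v → (v₀ : v 0 ≡ 0ℤ) →
  NonNegativeCoeffs q →
  NonNegativeCoeffs (poch (⊝ q) q (suc M)
    ⊛ inv (denom u v q 1 (suc M)) (denom-const₁ u v q 1 (suc M) u₀ v₀))
fraction-nonNeg {u} {v} {q} k M u≗vᵏ u≥0 u₀ v≥0 v₀ q≥0 =
  quotient-nonNeg k M u≗vᵏ u≥0 u₀ v≥0 v₀ q≥0 (poch-⊝-nonNeg (suc M) q≥0 q≥0)
    (⊛-inv-cancel (denom u v q 1 (suc M)) (poch (⊝ q) q (suc M))
                  (denom-const₁ u v q 1 (suc M) u₀ v₀))

X^-nonNeg : ∀ n → NonNegativeCoeffs (X ^ˢ n)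
X^-nonNeg n = ^ˢ-nonNeg n X-nonNeg

theorem3p1 : (∀ (k M : ℕ) .{{_ : NonZero k}} .{{_ : NonZero M}} →
    NonNegativeCoeffs (G k 1 M))
    ×
    (∀ (a b M : ℕ) .{{_ : NonZero a}} .{{_ : NonZero b}} .{{_ : NonZero M}} →
    b ∣ a → NonNegativeCoeffs (g a b (a + b) 1 M))
theorem3p1 = G-nonNeg , g-nonNeg
  where
  G-nonNeg : ∀ (k M : ℕ) .{{_ : NonZero k}} .{{_ : NonZero M}} →
             NonNegativeCoeffs (G k 1 M)
  G-nonNeg k (suc M) =
    fraction-nonNeg k M ≗-refl (X^-nonNeg k) (X^-const₀ k) X-nonNeg refl (X^-nonNeg (k + 1))

  g-nonNeg : ∀ (a b M : ℕ) .{{_ : NonZero a}} .{{_ : NonZero b}} .{{_ : NonZero M}} →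
             b ∣ a → NonNegativeCoeffs (g a b (a + b) 1 M)
  g-nonNeg a b (suc M) (divides k a≡k*b) =
    fraction-nonNeg k M Xᵃ≗[Xᵇ]ᵏ (X^-nonNeg a) (X^-const₀ a)
      (X^-nonNeg b) (X^-const₀ b) (X^-nonNeg (a + b))
    where
    -- Divisibility enters here: the cofactor `k` of `b` in `a` is the number of terms of the
    -- geometric sum in xᵇ.
    Xᵃ≗[Xᵇ]ᵏ : X ^ˢ a ≗ (X ^ˢ b) ^ˢ k
    Xᵃ≗[Xᵇ]ᵏ n = trans (cong (λ e → (X ^ˢ e) n) (trans a≡k*b (ℕₚ.*-comm k b)))
                       (sym (^ˢ-assocʳ X b k n))
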